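{- $\widehat{\mathsf{RC}}\equiv_{sW}\widehat{\mathsf D}\equiv_{sW}\widehat{\mathsf{WF}}$.
   Context: $\equiv_{sW}$ denotes strong Weihrauch equivalence; for a problem $\mathsf P$, $\widehat{\mathsf P}$ takes a sequence of $\mathsf P$-inputs and outputs the sequence of corresponding $\mathsf P$-solutions. Graphs are countable, given by vertex and edge sets. A coloring of $G$ is a map $c$ from vertices to $\mathbb N$ with adjacent vertices receiving distinct values. $\mathsf{RC}$: given a graph $G$, output $1$ if some coloring of $G$ uses one color infinitely often and $0$ otherwise. $\mathsf D$: given a graph $G$, output $1$ if $G$ has an infinite completely disconnected subgraph (an infinite set of pairwise non-adjacent vertices) and $0$ otherwise. $\mathsf{WF}$: given a tree $T\subseteq\mathbb N^{<\mathbb N}$, output $0$ if $T$ has an infinite path and $1$ if not. -}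

module Defs where

open import Data.Nat using (ℕ; _≤_)
open import Data.Bool using (Bool; true; false)
open import Data.List using (List; map; upTo; _++_)
open import Data.Product using (Σ; ∃; _×_; _,_)
open import Data.Sum using (_⊎_)
open import Relation.Nullary using (¬_)
open import Relation.Binary.PropositionalEquality using (_≡_; _≢_)

-- Problems (multi-valued partial functions between represented spaces),
-- realised on Agda types.  dom = the domain of the problem,
-- Sol x y = "y is an admissible output of the problem on input x".

record Problem : Set₁ where
  field
    In  : Set
    Out : Set
    dom : In → Set
    Sol : In → Out → Set

open Problem public

-- Strong Weihrauch reduction P ≤sW Q: a forward functional Φ and a
-- backward functional Ψ (Ψ does NOT see the original input).
-- Computability of Φ, Ψ is realised by their being Agda functions.
_≤sW_ : Problem → Problem → Set
P ≤sW Q =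
  Σ (In P → In Q) λ Φ →
  Σ (Out Q → Out P) λ Ψ →
  ∀ x → dom P x →
    dom Q (Φ x) × (∀ y → Sol Q (Φ x) y → Sol P x (Ψ y))

_≡sW_ : Problem → Problem → Set
P ≡sW Q = (P ≤sW Q) × (Q ≤sW P)

parallel : Problem → Problem
parallel P = record
  { In  = ℕ → In P
  ; Out = ℕ → Out P
  ; dom = λ xs → ∀ n → dom P (xs n)
  ; Sol = λ xs ys → ∀ n → Sol P (xs n) (ys n)
  }

record Graph : Set where
  field
    V : ℕ → Bool
    E : ℕ → ℕ → Bool

open Graph public

IsGraph : Graph → Set
IsGraph G =
  (∀ x y → E G x y ≡ true → E G y x ≡ true) ×
  (∀ x → E G x x ≡ false) ×
  (∀ x y → E G x y ≡ true → (V G x ≡ true × V G y ≡ true))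

IsColoring : Graph → (ℕ → ℕ) → Set
IsColoring G c = ∀ x y → V G x ≡ true → V G y ≡ true →
  E G x y ≡ true → c x ≢ c y

UsesColorInfinitelyOften : Graph → (ℕ → ℕ) → Set
UsesColorInfinitelyOften G c =
  ∃ λ k → ∀ n → ∃ λ v → n ≤ v × V G v ≡ true × c v ≡ k

RCProp : Graph → Set
RCProp G = ∃ λ c → IsColoring G c × UsesColorInfinitelyOften G c

DProp : Graph → Set
DProp G = ∃ λ (S : ℕ → Bool) →
  (∀ x → S x ≡ true → V G x ≡ true) ×
  (∀ n → ∃ λ v → n ≤ v × S v ≡ true) ×
  (∀ x y → S x ≡ true → S y ≡ true → E G x y ≡ false)

-- Output true (= 1) iff the property holds, false (= 0) otherwise.
Decides : Set → Bool → Set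
Decides A b = (b ≡ true × A) ⊎ (b ≡ false × ¬ A)

RC : Problem
RC = record { In = Graph ; Out = Bool ; dom = IsGraph
            ; Sol = λ G b → Decides (RCProp G) b }

D : Problem
D = record { In = Graph ; Out = Bool ; dom = IsGraph
           ; Sol = λ G b → Decides (DProp G) b }

Tree : Set
Tree = List ℕ → Bool

IsTree : Tree → Set
IsTree T = ∀ σ τ → T (σ ++ τ) ≡ true → T σ ≡ true

prefix : (ℕ → ℕ) → ℕ → List ℕ
prefix f n = map f (upTo n)

HasPath : Tree → Set
HasPath T = ∃ λ (f : ℕ → ℕ) → ∀ n → T (prefix f n) ≡ true

WF : Problem
WF = record { In = Tree ; Out = Bool ; dom = IsTree
            ; Sol = λ T b → (b ≡ false × HasPath T) ⊎ (b ≡ true × ¬ HasPath T) }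

-- All three problems decide a property of their input, and the properties
-- are interreducible by uniform (strong Weihrauch) maps, which then lift
-- to the parallelizations componentwise.
--
-- RC ⇔ D: a colour used infinitely often gives an infinite independent set
-- (its colour class); conversely, colour an infinite independent set with 0
-- and every other vertex x with x + 1.
--
-- D ≤ WF: G has an infinite independent set iff the tree of increasing
-- finite sequences of pairwise non-adjacent vertices has a path; the range
-- of an increasing path is decidable.
--
-- WF ≤ D: join two codes of nodes of T when the nodes are incomparable.
-- A path gives an independent set of codes of its prefixes; conversely an
-- infinite independent set is an infinite chain of distinct, pairwise
-- comparable nodes, whose lengths are pairwise distinct and hence
-- unbounded, so the chain determines a path.
module Submission where

open import Defs
open import Data.Bool using (Bool; true; false; not; if_then_else_)
import Data.Bool.Properties as Bool
open import Data.Fin using (Fin; toℕ; fromℕ<)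
open import Data.Fin.Properties using (pigeonhole; toℕ<n; fromℕ<-injective)
open import Data.List using (List; []; _∷_; _++_; length; applyUpTo)
open import Data.List.Properties using (map-upTo; length-applyUpTo; ≡-dec)
open import Data.List.Relation.Unary.All using (All; []; _∷_; all?)
import Data.List.Relation.Unary.All.Properties as All
open import Data.List.Relation.Unary.AllPairs using (AllPairs; []; _∷_; allPairs?)
import Data.List.Relation.Unary.AllPairs.Properties as AllPairs
open import Data.List.Relation.Binary.Pointwise using (Pointwise-≡⇒≡; ≡⇒Pointwise-≡)
open import Data.List.Relation.Binary.Prefix.Heterogeneous
  using (Prefix; []; _∷_; toView) renaming (_++_ to _++ᵛ_)
open import Data.List.Relation.Binary.Prefix.Heterogeneous.Properties
  using (fromPointwise; toPointwise; prefix?)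
open import Data.Nat using (ℕ; zero; suc; _+_; _≤_; _<_; z≤n; s≤s; _≟_; _≤?_; _<?_)
open import Data.Nat.Properties
  using ( ≤-refl; ≤-trans; ≤-reflexive; <-trans; <-cmp; <⇒≢; ≤-total; ≰⇒>
        ; m≤n⇒m<n∨m≡n; n<1+n; suc-injective; +-suc; +-identityʳ; m≤n+m; m≤m+n
        ; anyUpTo? )
open import Data.Product using (∃; _×_; _,_; proj₁; proj₂)
open import Data.Sum using (_⊎_; inj₁; inj₂)
open import Function using (_∘_; _⇔_; mk⇔; Equivalence)
open import Relation.Binary.Definitions using (tri<; tri≈; tri>)
open import Relation.Binary.PropositionalEquality
  using (_≡_; refl; sym; trans; cong; subst; subst₂)
open import Relation.Nullary using (Dec; yes; no; does; ¬_; ¬?; contradiction)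
open import Relation.Nullary.Decidable using (dec-true; dec-false; _×-dec_; _⊎-dec_; decidable-stable)

dec-true⁻¹ : ∀ {a} {A : Set a} (a? : Dec A) → does a? ≡ true → A
dec-true⁻¹ (yes a) _ = a
dec-true⁻¹ (no _) ()

dec-false⁻¹ : ∀ {a} {A : Set a} (a? : Dec A) → does a? ≡ false → ¬ A
dec-false⁻¹ (yes _) ()
dec-false⁻¹ (no ¬a) _ = ¬a

Decides-⇔ : ∀ {A B : Set} {b} → A ⇔ B → Decides A b → Decides B b
Decides-⇔ A⇔B (inj₁ (b≡true , a)) = inj₁ (b≡true , Equivalence.to A⇔B a)
Decides-⇔ A⇔B (inj₂ (b≡false , ¬a)) = inj₂ (b≡false , ¬a ∘ Equivalence.from A⇔B)

WF-solution⇒Decides : ∀ {T b} → Sol WF T b → Decides (HasPath T) (not b)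
WF-solution⇒Decides (inj₁ (refl , has-path)) = inj₁ (refl , has-path)
WF-solution⇒Decides (inj₂ (refl , no-path))  = inj₂ (refl , no-path)

Decides⇒WF-solution : ∀ {T b} → Decides (HasPath T) b → Sol WF T (not b)
Decides⇒WF-solution (inj₁ (refl , has-path)) = inj₁ (refl , has-path)
Decides⇒WF-solution (inj₂ (refl , no-path))  = inj₂ (refl , no-path)

parallel-mono : ∀ {P Q} → P ≤sW Q → parallel P ≤sW parallel Q
parallel-mono (Φ , Ψ , reduces) =
  (λ xs n → Φ (xs n)) , (λ ys n → Ψ (ys n)) ,
  λ xs xs∈dom → (λ n → proj₁ (reduces (xs n) (xs∈dom n))) ,
                λ ys sols n → proj₂ (reduces (xs n) (xs∈dom n)) (ys n) (sols n)

parallel-cong : ∀ {P Q} → P ≡sW Q → parallel P ≡sW parallel Q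
parallel-cong {P} {Q} (P≤Q , Q≤P) = parallel-mono {P} {Q} P≤Q , parallel-mono {Q} {P} Q≤P

Increasing : (ℕ → ℕ) → Set
Increasing f = ∀ n → f n < f (suc n)

module _ {f : ℕ → ℕ} (increasing : Increasing f) where

  increasing⇒strictMono : ∀ {i j} → i < j → f i < f j
  increasing⇒strictMono {i} {suc j} (s≤s i≤j) with m≤n⇒m<n∨m≡n i≤j
  ... | inj₁ i<j  = <-trans (increasing⇒strictMono i<j) (increasing j)
  ... | inj₂ refl = increasing j

  increasing⇒injective : ∀ {i j} → f i ≡ f j → i ≡ j
  increasing⇒injective {i} {j} fi≡fj with <-cmp i j
  ... | tri< i<j _ _ = contradiction fi≡fj (<⇒≢ (increasing⇒strictMono i<j))
  ... | tri≈ _ i≡j _ = i≡j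
  ... | tri> _ _ j<i = contradiction (sym fi≡fj) (<⇒≢ (increasing⇒strictMono j<i))

  increasing⇒inflationary : ∀ n → n ≤ f n
  increasing⇒inflationary zero    = z≤n
  increasing⇒inflationary (suc n) = ≤-trans (s≤s (increasing⇒inflationary n)) (increasing n)

Unbounded : (ℕ → Bool) → Set
Unbounded S = ∀ n → ∃ λ v → n ≤ v × S v ≡ true

module Enumeration (S : ℕ → Bool) (unbounded : Unbounded S) where

  enum : ℕ → ℕ
  enum zero    = proj₁ (unbounded 0)
  enum (suc n) = proj₁ (unbounded (suc (enum n)))

  enum-∈ : ∀ n → S (enum n) ≡ true
  enum-∈ zero    = proj₂ (proj₂ (unbounded 0))
  enum-∈ (suc n) = proj₂ (proj₂ (unbounded (suc (enum n))))

  enum-increasing : Increasing enum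
  enum-increasing n = proj₁ (proj₂ (unbounded (suc (enum n))))

-- By pigeonhole, h cannot send all of 0 … n into 0 … n - 1.
injective⇒unbounded : (h : ℕ → ℕ) → (∀ {i j} → h i ≡ h j → i ≡ j) →
                      ∀ n → ∃ λ i → n ≤ h i
injective⇒unbounded h injective n with anyUpTo? (λ i → n ≤? h i) (suc n)
... | yes (i , _ , n≤hi) = i , n≤hi
... | no none with pigeonhole (n<1+n n) squeeze
  where
  squeeze : Fin (suc n) → Fin n
  squeeze k = fromℕ< (≰⇒> λ n≤hk → none (toℕ k , toℕ<n k , n≤hk))
... | i , j , i<j , squeeze-i≡squeeze-j =
  contradiction (injective (fromℕ<-injective _ _ _ _ squeeze-i≡squeeze-j)) (<⇒≢ i<j)

RCProp⇒DProp : ∀ {G} → RCProp G → DProp G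
RCProp⇒DProp {G} (c , coloring , k , often) = colour-class , ⊆V , unbounded , independent
  where
  colour-class? : ∀ x → Dec (V G x ≡ true × c x ≡ k)
  colour-class? x = V G x Bool.≟ true ×-dec c x ≟ k

  colour-class : ℕ → Bool
  colour-class = does ∘ colour-class?

  ⊆V : ∀ x → colour-class x ≡ true → V G x ≡ true
  ⊆V x x∈ = proj₁ (dec-true⁻¹ (colour-class? x) x∈)

  unbounded : Unbounded colour-class
  unbounded n =
    let (v , n≤v , v∈V , cv≡k) = often n in v , n≤v , dec-true (colour-class? v) (v∈V , cv≡k)

  independent : ∀ x y → colour-class x ≡ true → colour-class y ≡ true → E G x y ≡ false
  independent x y x∈ y∈ with E G x y in xy-edge
  ... | false = refl
  ... | true  =
    let (x∈V , cx≡k) = dec-true⁻¹ (colour-class? x) x∈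
        (y∈V , cy≡k) = dec-true⁻¹ (colour-class? y) y∈
    in contradiction (trans cx≡k (sym cy≡k)) (coloring x y x∈V y∈V xy-edge)

DProp⇒RCProp : ∀ {G} → IsGraph G → DProp G → RCProp G
DProp⇒RCProp {G} (_ , irreflexive , _) (S , ⊆V , unbounded , independent) =
  c , coloring , 0 , often
  where
  c : ℕ → ℕ
  c x = if S x then 0 else suc x

  collision : ∀ x y → c x ≡ c y → (S x ≡ true × S y ≡ true) ⊎ x ≡ y
  collision x y with S x | S y
  ... | true  | true  = λ _ → inj₁ (refl , refl)
  ... | true  | false = λ ()
  ... | false | true  = λ ()
  ... | false | false = inj₂ ∘ suc-injective

  coloring : IsColoring G c
  coloring x y _ _ xy-edge cx≡cy with collision x y cx≡cy
  ... | inj₁ (x∈ , y∈) = contradiction (trans (sym xy-edge) (independent x y x∈ y∈)) λ ()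
  ... | inj₂ refl      = contradiction (trans (sym xy-edge) (irreflexive x)) λ ()

  often : ∀ n → ∃ λ v → n ≤ v × V G v ≡ true × c v ≡ 0
  often n with unbounded n
  ... | v , n≤v , v∈ = v , n≤v , ⊆V v v∈ , cong (λ b → if b then 0 else suc v) v∈

Comparable : List ℕ → List ℕ → Set
Comparable σ τ = Prefix _≡_ σ τ ⊎ Prefix _≡_ τ σ

comparable? : ∀ σ τ → Dec (Comparable σ τ)
comparable? σ τ = prefix? _≟_ σ τ ⊎-dec prefix? _≟_ τ σ

comparable-refl : ∀ {σ} → Comparable σ σ
comparable-refl = inj₁ (fromPointwise (≡⇒Pointwise-≡ refl))

comparable-sym : ∀ {σ τ} → Comparable σ τ → Comparable τ σ
comparable-sym (inj₁ σ≤τ) = inj₂ σ≤τ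
comparable-sym (inj₂ τ≤σ) = inj₁ τ≤σ

comparable∧length≡⇒≡ : ∀ {σ τ} → Comparable σ τ → length σ ≡ length τ → σ ≡ τ
comparable∧length≡⇒≡ (inj₁ σ≤τ) |σ|≡|τ| = Pointwise-≡⇒≡ (toPointwise |σ|≡|τ| σ≤τ)
comparable∧length≡⇒≡ (inj₂ τ≤σ) |σ|≡|τ| = sym (Pointwise-≡⇒≡ (toPointwise (sym |σ|≡|τ|) τ≤σ))

applyUpTo-prefix : ∀ (f : ℕ → ℕ) {m n} → m ≤ n → Prefix _≡_ (applyUpTo f m) (applyUpTo f n)
applyUpTo-prefix f {zero}          _         = []
applyUpTo-prefix f {suc m} {suc n} (s≤s m≤n) = refl ∷ applyUpTo-prefix (f ∘ suc) m≤n

applyUpTo-comparable : ∀ (f : ℕ → ℕ) m n → Comparable (applyUpTo f m) (applyUpTo f n)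
applyUpTo-comparable f m n with ≤-total m n
... | inj₁ m≤n = inj₁ (applyUpTo-prefix f m≤n)
... | inj₂ n≤m = inj₂ (applyUpTo-prefix f n≤m)

prefix-closed : ∀ {T σ τ} → IsTree T → Prefix _≡_ σ τ → T τ ≡ true → T σ ≡ true
prefix-closed {T} isTree σ≤τ Tτ with toView σ≤τ
... | σ≈ρ ++ᵛ rest = subst (λ ρ → T ρ ≡ true) (sym (Pointwise-≡⇒≡ σ≈ρ)) (isTree _ rest Tτ)

-- The i-th entry, with junk value 0 beyond the end.
nth : List ℕ → ℕ → ℕ
nth []      _       = 0
nth (x ∷ _) zero    = x
nth (_ ∷ σ) (suc i) = nth σ i

prefix-nth : ∀ {σ τ i} → Prefix _≡_ σ τ → i < length σ → nth σ i ≡ nth τ i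
prefix-nth {i = zero}  (refl ∷ _)   _         = refl
prefix-nth {i = suc i} (refl ∷ σ≤τ) (s≤s i<n) = prefix-nth σ≤τ i<n

comparable-nth : ∀ {σ τ i} → Comparable σ τ → i < length σ → i < length τ → nth σ i ≡ nth τ i
comparable-nth (inj₁ σ≤τ) i<|σ| _     = prefix-nth σ≤τ i<|σ|
comparable-nth (inj₂ τ≤σ) _     i<|τ| = sym (prefix-nth τ≤σ i<|τ|)

applyUpTo-prefix-of : ∀ (f : ℕ → ℕ) n σ → n ≤ length σ → (∀ {i} → i < n → f i ≡ nth σ i) →
                      Prefix _≡_ (applyUpTo f n) σ
applyUpTo-prefix-of f zero    σ       _         _     = []
applyUpTo-prefix-of f (suc n) (x ∷ σ) (s≤s n≤m) agree =
  agree (s≤s z≤n) ∷ applyUpTo-prefix-of (f ∘ suc) n σ n≤m (agree ∘ s≤s)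

-- A chain whose n-th member has length ≥ n converges to the path
-- reading entry i off member i + 1.
limit : (ℕ → List ℕ) → ℕ → ℕ
limit r i = nth (r (suc i)) i

limit-prefix : (r : ℕ → List ℕ) → (∀ i j → Comparable (r i) (r j)) → (∀ n → n ≤ length (r n)) →
               ∀ n → Prefix _≡_ (applyUpTo (limit r) n) (r n)
limit-prefix r chain long n = applyUpTo-prefix-of (limit r) n (r n) (long n)
  λ {i} i<n → comparable-nth (chain (suc i) n) (long (suc i)) (≤-trans i<n (long n))

allPairs-applyUpTo⁻ : ∀ {A : Set} {R : A → A → Set} (f : ℕ → A) n → AllPairs R (applyUpTo f n) →
                      ∀ {i j} → i < j → j < n → R (f i) (f j)
allPairs-applyUpTo⁻ f (suc n) (fi<rest ∷ _) {zero} {suc j} _ (s≤s j<n) =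
  All.applyUpTo⁻ (f ∘ suc) n fi<rest j<n
allPairs-applyUpTo⁻ f (suc n) (_ ∷ rest) {suc i} {suc j} (s≤s i<j) (s≤s j<n) =
  allPairs-applyUpTo⁻ (f ∘ suc) n rest i<j j<n

allPairs-++⁻ˡ : ∀ {A : Set} {R : A → A → Set} (σ : List A) {τ} → AllPairs R (σ ++ τ) → AllPairs R σ
allPairs-++⁻ˡ []      _                  = []
allPairs-++⁻ˡ (x ∷ σ) (x<στ ∷ pairs-στ) = All.++⁻ˡ σ x<στ ∷ allPairs-++⁻ˡ σ pairs-στ

non-adjacent-sym : ∀ {G} → IsGraph G → ∀ x y → E G y x ≡ false → E G x y ≡ false
non-adjacent-sym {G} (symmetric , _) x y yx-free with E G x y in xy-edge
... | false = refl
... | true  = contradiction (trans (sym (symmetric x y xy-edge)) yx-free) λ ()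

module IndependentTree (G : Graph) where

  Ascending : ℕ → ℕ → Set
  Ascending x y = x < y × E G x y ≡ false

  IndependentChain : List ℕ → Set
  IndependentChain σ = All (λ x → V G x ≡ true) σ × AllPairs Ascending σ

  independentChain? : ∀ σ → Dec (IndependentChain σ)
  independentChain? σ =
    all? (λ x → V G x Bool.≟ true) σ ×-dec allPairs? (λ x y → x <? y ×-dec E G x y Bool.≟ false) σ

  tree : Tree
  tree = does ∘ independentChain?

  isTree : IsTree tree
  isTree σ τ στ∈ =
    let (vertices , ascending) = dec-true⁻¹ (independentChain? (σ ++ τ)) στ∈
    in dec-true (independentChain? σ) (All.++⁻ˡ σ vertices , allPairs-++⁻ˡ σ ascending)

  path-chain : ∀ {f} → (∀ n → tree (prefix f n) ≡ true) → ∀ n → IndependentChain (applyUpTo f n)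
  path-chain {f} path n =
    dec-true⁻¹ (independentChain? _) (subst (λ σ → tree σ ≡ true) (map-upTo f n) (path n))

  HasPath⇒DProp : IsGraph G → HasPath tree → DProp G
  HasPath⇒DProp isGraph (f , path) = range , ⊆V , unbounded , independent
    where
    ascending : ∀ {i j} → i < j → Ascending (f i) (f j)
    ascending {i} {j} i<j = allPairs-applyUpTo⁻ f (suc j) (proj₂ (path-chain path (suc j))) i<j ≤-refl

    increasing : Increasing f
    increasing n = proj₁ (ascending (n<1+n n))

    -- f is increasing, so x can only be hit at an index i ≤ x.
    range? : ∀ x → Dec (∃ λ i → i < suc x × f i ≡ x)
    range? x = anyUpTo? (λ i → f i ≟ x) (suc x)

    range : ℕ → Bool
    range = does ∘ range?

    ⊆V : ∀ x → range x ≡ true → V G x ≡ true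
    ⊆V x x∈ with dec-true⁻¹ (range? x) x∈
    ... | i , _ , refl = All.applyUpTo⁻ f (suc i) (proj₁ (path-chain path (suc i))) ≤-refl

    unbounded : Unbounded range
    unbounded n = f n , increasing⇒inflationary increasing n ,
      dec-true (range? (f n)) (n , s≤s (increasing⇒inflationary increasing n) , refl)

    independent : ∀ x y → range x ≡ true → range y ≡ true → E G x y ≡ false
    independent x y x∈ y∈ with dec-true⁻¹ (range? x) x∈ | dec-true⁻¹ (range? y) y∈
    ... | i , _ , refl | j , _ , refl with <-cmp i j
    ... | tri< i<j _ _ = proj₂ (ascending i<j)
    ... | tri≈ _ refl _ = proj₁ (proj₂ isGraph) (f i)
    ... | tri> _ _ j<i = non-adjacent-sym isGraph (f i) (f j) (proj₂ (ascending j<i))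

  DProp⇒HasPath : DProp G → HasPath tree
  DProp⇒HasPath (S , ⊆V , unbounded , independent) = enum , path
    where
    open Enumeration S unbounded

    path : ∀ n → tree (prefix enum n) ≡ true
    path n = subst (λ σ → tree σ ≡ true) (sym (map-upTo enum n)) (dec-true (independentChain? _)
      ( All.applyUpTo⁺₂ enum n (λ i → ⊆V _ (enum-∈ i))
      , AllPairs.applyUpTo⁺₁ enum n (λ {i} {j} i<j _ →
          increasing⇒strictMono enum-increasing i<j , independent _ _ (enum-∈ i) (enum-∈ j))))

  HasPath⇔DProp : IsGraph G → HasPath tree ⇔ DProp G
  HasPath⇔DProp isGraph = mk⇔ (HasPath⇒DProp isGraph) DProp⇒HasPath

-- Coding finite sequences by natural numbers

-- unpair walks the diagonals a + b = s in the order (0 , s), (1 , s - 1), …,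
-- and triangle s counts the pairs on the diagonals before s.
unpair : ℕ → ℕ × ℕ
unpair zero = 0 , 0
unpair (suc n) with unpair n
... | a , zero  = 0 , suc a
... | a , suc b = suc a , b

triangle : ℕ → ℕ
triangle zero    = 0
triangle (suc s) = triangle s + suc s

pair : ℕ → ℕ → ℕ
pair a b = triangle (a + b) + a

unpair-diagonal : ∀ s → unpair (triangle s) ≡ (0 , s) →
                  ∀ a b → a + b ≡ s → unpair (triangle s + a) ≡ (a , b)
unpair-diagonal s start zero b refl rewrite +-identityʳ (triangle b) = start
unpair-diagonal s start (suc a) b a+1+b≡s
  rewrite +-suc (triangle s) a
        | unpair-diagonal s start a (suc b) (trans (+-suc a b) a+1+b≡s) = refl

unpair-triangle : ∀ s → unpair (triangle s) ≡ (0 , s)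
unpair-triangle zero = refl
unpair-triangle (suc s)
  rewrite +-suc (triangle s) s
        | unpair-diagonal s (unpair-triangle s) s 0 (+-identityʳ s) = refl

unpair-pair : ∀ a b → unpair (pair a b) ≡ (a , b)
unpair-pair a b = unpair-diagonal (a + b) (unpair-triangle (a + b)) a b refl

triangle-inflationary : ∀ s → s ≤ triangle s
triangle-inflationary zero    = z≤n
triangle-inflationary (suc s) = m≤n+m (suc s) (triangle s)

right≤pair : ∀ a b → b ≤ pair a b
right≤pair a b = ≤-trans (m≤n+m b a) (≤-trans (triangle-inflationary (a + b)) (m≤m+n _ a))

encode : List ℕ → ℕ
encode []      = 0
encode (x ∷ σ) = suc (pair x (encode σ))

-- The first argument is fuel; decoding n needs at most n steps.
decodeWithin : ℕ → ℕ → List ℕ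
decodeWithin zero    _       = []
decodeWithin (suc k) zero    = []
decodeWithin (suc k) (suc m) = proj₁ (unpair m) ∷ decodeWithin k (proj₂ (unpair m))

decode : ℕ → List ℕ
decode n = decodeWithin n n

decodeWithin-encode : ∀ σ k → encode σ ≤ k → decodeWithin k (encode σ) ≡ σ
decodeWithin-encode []      zero    _ = refl
decodeWithin-encode []      (suc k) _ = refl
decodeWithin-encode (x ∷ σ) (suc k) (s≤s code≤k) rewrite unpair-pair x (encode σ) =
  cong (x ∷_) (decodeWithin-encode σ k (≤-trans (right≤pair x (encode σ)) code≤k))

decode-encode : ∀ σ → decode (encode σ) ≡ σ
decode-encode σ = decodeWithin-encode σ (encode σ) ≤-refl

length≤encode : ∀ σ → length σ ≤ encode σ
length≤encode []      = z≤n
length≤encode (x ∷ σ) = s≤s (≤-trans (length≤encode σ) (right≤pair x (encode σ)))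

-- The incomparability graph of a tree

module CompatibilityGraph (T : Tree) where

  -- Only canonical codes are vertices, so distinct vertices code distinct nodes.
  Node : ℕ → Set
  Node v = T (decode v) ≡ true × encode (decode v) ≡ v

  node? : ∀ v → Dec (Node v)
  node? v = T (decode v) Bool.≟ true ×-dec encode (decode v) ≟ v

  Clash : ℕ → ℕ → Set
  Clash v w = Node v × Node w × ¬ Comparable (decode v) (decode w)

  clash? : ∀ v w → Dec (Clash v w)
  clash? v w = node? v ×-dec node? w ×-dec ¬? (comparable? (decode v) (decode w))

  graph : Graph
  graph = record { V = does ∘ node? ; E = λ v w → does (clash? v w) }

  isGraph : IsGraph graph
  isGraph = symmetric , irreflexive , endpoints
    where
    symmetric : ∀ v w → E graph v w ≡ true → E graph w v ≡ true
    symmetric v w vw-edge =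
      let (v-node , w-node , incomparable) = dec-true⁻¹ (clash? v w) vw-edge
      in dec-true (clash? w v) (w-node , v-node , incomparable ∘ comparable-sym)

    irreflexive : ∀ v → E graph v v ≡ false
    irreflexive v = dec-false (clash? v v) λ (_ , _ , incomparable) → incomparable comparable-refl

    endpoints : ∀ v w → E graph v w ≡ true → V graph v ≡ true × V graph w ≡ true
    endpoints v w vw-edge =
      let (v-node , w-node , _) = dec-true⁻¹ (clash? v w) vw-edge
      in dec-true (node? v) v-node , dec-true (node? w) w-node

  independent⇒comparable : ∀ {v w} → Node v → Node w → E graph v w ≡ false →
                           Comparable (decode v) (decode w)
  independent⇒comparable v-node w-node vw-free = decidable-stable (comparable? _ _)
    λ incomparable → dec-false⁻¹ (clash? _ _) vw-free (v-node , w-node , incomparable)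

  HasPath⇒DProp : HasPath T → DProp graph
  HasPath⇒DProp (f , path) = on-path , ⊆V , unbounded , independent
    where
    OnPath : ℕ → Set
    OnPath v = encode (decode v) ≡ v × decode v ≡ applyUpTo f (length (decode v))

    on-path? : ∀ v → Dec (OnPath v)
    on-path? v = encode (decode v) ≟ v ×-dec ≡-dec _≟_ (decode v) (applyUpTo f (length (decode v)))

    on-path : ℕ → Bool
    on-path = does ∘ on-path?

    on-path⇒OnPath : ∀ v → on-path v ≡ true → OnPath v
    on-path⇒OnPath v = dec-true⁻¹ (on-path? v)

    ⊆V : ∀ v → on-path v ≡ true → V graph v ≡ true
    ⊆V v v∈ = let (canonical , v-prefix) = on-path⇒OnPath v v∈ in
      dec-true (node? v)
        ( subst (λ σ → T σ ≡ true) (sym (trans v-prefix (sym (map-upTo f _)))) (path _)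
        , canonical )

    prefix-on-path : ∀ n → OnPath (encode (applyUpTo f n))
    prefix-on-path n rewrite decode-encode (applyUpTo f n) | length-applyUpTo f n = refl , refl

    unbounded : Unbounded on-path
    unbounded n = encode (applyUpTo f n)
      , ≤-trans (≤-reflexive (sym (length-applyUpTo f n))) (length≤encode _)
      , dec-true (on-path? _) (prefix-on-path n)

    independent : ∀ v w → on-path v ≡ true → on-path w ≡ true → E graph v w ≡ false
    independent v w v∈ w∈ = dec-false (clash? v w) λ (_ , _ , incomparable) → incomparable
      (subst₂ Comparable (sym (proj₂ (on-path⇒OnPath v v∈))) (sym (proj₂ (on-path⇒OnPath w w∈)))
        (applyUpTo-comparable f _ _))

  DProp⇒HasPath : IsTree T → DProp graph → HasPath T
  DProp⇒HasPath isTree (S , ⊆V , unbounded , independent) = limit chain , path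
    where
    open Enumeration S unbounded

    node : ∀ i → Node (enum i)
    node i = dec-true⁻¹ (node? _) (⊆V _ (enum-∈ i))

    ρ : ℕ → List ℕ
    ρ i = decode (enum i)

    ρ-comparable : ∀ i j → Comparable (ρ i) (ρ j)
    ρ-comparable i j = independent⇒comparable (node i) (node j) (independent _ _ (enum-∈ i) (enum-∈ j))

    length-injective : ∀ {i j} → length (ρ i) ≡ length (ρ j) → i ≡ j
    length-injective {i} {j} |ρi|≡|ρj| = increasing⇒injective enum-increasing
      (trans (sym (proj₂ (node i)))
        (trans (cong encode (comparable∧length≡⇒≡ (ρ-comparable i j) |ρi|≡|ρj|)) (proj₂ (node j))))

    long : ℕ → ℕ
    long n = proj₁ (injective⇒unbounded (length ∘ ρ) length-injective n)

    chain : ℕ → List ℕ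
    chain n = ρ (long n)

    path : ∀ n → T (prefix (limit chain) n) ≡ true
    path n = subst (λ σ → T σ ≡ true) (sym (map-upTo (limit chain) n))
      (prefix-closed isTree
        (limit-prefix chain (λ i j → ρ-comparable (long i) (long j))
          (λ m → proj₂ (injective⇒unbounded (length ∘ ρ) length-injective m)) n)
        (proj₁ (node (long n))))

  DProp⇔HasPath : IsTree T → DProp graph ⇔ HasPath T
  DProp⇔HasPath isTree = mk⇔ (DProp⇒HasPath isTree) HasPath⇒DProp

RC≡sWD : RC ≡sW D
RC≡sWD =
  ( (λ G → G) , (λ b → b) , λ G isGraph → isGraph , λ _ →
      Decides-⇔ (mk⇔ (DProp⇒RCProp isGraph) RCProp⇒DProp) )
  , ( (λ G → G) , (λ b → b) , λ G isGraph → isGraph , λ _ →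
      Decides-⇔ (mk⇔ RCProp⇒DProp (DProp⇒RCProp isGraph)) )

D≡sWWF : D ≡sW WF
D≡sWWF =
  ( IndependentTree.tree , not , λ G isGraph → IndependentTree.isTree G , λ _ →
      Decides-⇔ (IndependentTree.HasPath⇔DProp G isGraph) ∘ WF-solution⇒Decides {IndependentTree.tree G} )
  , ( CompatibilityGraph.graph , not , λ T isTree → CompatibilityGraph.isGraph T , λ _ →
      Decides⇒WF-solution {T} ∘ Decides-⇔ (CompatibilityGraph.DProp⇔HasPath T isTree) )

corollary30 : (parallel RC ≡sW parallel D) × (parallel D ≡sW parallel WF)
corollary30 = parallel-cong {RC} {D} RC≡sWD , parallel-cong {D} {WF} D≡sWWF
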